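{- There exists $n_0\in\mathbb N$ such that for every integer $n>n_0$, the random graph $G(n,\frac12)$ satisfies $$\Pr\left(\kappa_Q\left(G(n,\tfrac12)\right)<0.811\,n\right)\ge 1-\frac1n .$$
   Context: $G(n,\frac12)$ is the random simple graph on $n$ vertices in which each pair of distinct vertices is joined by an edge independently with probability $1/2$. For a finite simple undirected graph $G=(V,E)$ and $C\subseteq V$, let $Odd(C)=\{v\in V : |N(v)\cap C|\equiv 1 \pmod 2\}$, where $N(v)$ is the open neighborhood of $v$. A set $B\subseteq V$ is a weak odd dominated (WOD) set if there exists $C\subseteq V\setminus B$ with $B\subseteq Odd(C)$. Let $\kappa(G)$ be the maximum size of a WOD set of $G$ and $\kappa'(G)$ the minimum size of a subset of $V$ that is not a WOD set. With $n=|V|$, $\kappa_Q(G)=\max(\kappa(G),\,n-\kappa'(G))$. -}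

module Defs where

open import Data.Bool.Base using (Bool; true; false)
open import Data.Fin.Base using (Fin; zero; suc)
open import Data.Fin.Subset using (Subset; inside; outside; _⊆_; ∁; _∩_; ∣_∣; ⊥; ⊤)
open import Data.Fin.Subset.Properties using (anySubset?; _⊆?_; ⊆-min; ∈⊤; x∈p⇒x∉∁p; ∣⊥∣≡0; x∈p∩q⁻; Empty-unique)
open import Data.List.Base using (List; []; _∷_; [_]; _++_; map; concatMap; filter; foldr)
open import Data.List.Extrema.Nat using (argmax; argmin; argmax-all; argmin-all; f[xs]≤f[argmax]; f[argmin]≤f[xs])
open import Data.List.Membership.Propositional using (_∈_)
open import Data.List.Membership.Propositional.Properties using (∈-map⁺; ∈-++⁺ˡ; ∈-++⁺ʳ; ∈-filter⁺)
open import Data.List.Relation.Unary.All as All using (All)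
open import Data.List.Relation.Unary.All.Properties using (all-filter)
open import Data.List.Relation.Unary.Any using (here)
open import Data.Nat.Base as ℕ using (ℕ; zero; suc; _⊔_; _∸_; _%_)
import Data.Nat.Properties as ℕ
open import Data.Product.Base using (∃; _×_; _,_; proj₁; proj₂; map₁)
open import Data.Rational.Base using (ℚ; 0ℚ; 1ℚ; ½; _+_; _*_)
open import Data.Vec.Base using (Vec; []; _∷_; lookup; tabulate)
open import Data.Vec.Properties using ([]=⇒lookup; lookup∘tabulate)
open import Relation.Binary.PropositionalEquality using (_≡_; refl; sym; trans; cong)
open import Relation.Nullary using (¬_; Dec; does; ¬?; _×-dec_)
open import Relation.Unary using (Decidable)

private
  variable
    A B : Set
    n   : ℕ

------------------------------------------------------------------------
-- Finite simple undirected graphs on the vertex set Fin n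

record Graph (n : ℕ) : Set where
  field
    adj        : Fin n → Fin n → Bool
    adj-sym    : ∀ u v → adj u v ≡ adj v u
    adj-irrefl : ∀ v → adj v v ≡ false

open Graph

N : Graph n → Fin n → Subset n
N G v = tabulate (adj G v)

Odd : Graph n → Subset n → Subset n
Odd G C = tabulate λ v → does (∣ N G v ∩ C ∣ % 2 ℕ.≟ 1)

WOD : Graph n → Subset n → Set
WOD G B = ∃ λ C → C ⊆ ∁ B × B ⊆ Odd G C

WOD? : (G : Graph n) → Decidable (WOD G)
WOD? G B = anySubset? λ C → (C ⊆? ∁ B) ×-dec (B ⊆? Odd G C)

subsets : ∀ n → List (Subset n)
subsets zero    = [ [] ]
subsets (suc n) = map (inside ∷_) (subsets n) ++ map (outside ∷_) (subsets n)

-- The starting values of the two searches are harmless: ⊥ is always WOD and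
-- ⊤ is not WOD when n is positive; see κ-isMaximum and κ′-isMinimum below.
-- (For n = 0 every subset is WOD, and κ′ takes the junk value 0.)

κ : Graph n → ℕ
κ {n} G = ∣ argmax ∣_∣ ⊥ (filter (WOD? G) (subsets n)) ∣

κ′ : Graph n → ℕ
κ′ {n} G = ∣ argmin ∣_∣ ⊤ (filter (λ B → ¬? (WOD? G B)) (subsets n)) ∣

κQ : Graph n → ℕ
κQ {n} G = κ G ⊔ (n ∸ κ′ G)

------------------------------------------------------------------------
-- κ is the maximum size of a WOD set, κ′ the minimum size of a non-WOD set

∈-subsets : (B : Subset n) → B ∈ subsets n
∈-subsets []            = here refl
∈-subsets (inside  ∷ B) = ∈-++⁺ˡ (∈-map⁺ (inside ∷_) (∈-subsets B))
∈-subsets (outside ∷ B) = ∈-++⁺ʳ _ (∈-map⁺ (outside ∷_) (∈-subsets B))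

⊥-WOD : (G : Graph n) → WOD G ⊥
⊥-WOD G = ⊥ , ⊆-min _ , ⊆-min _

⊤-¬WOD : (G : Graph (suc n)) → ¬ WOD G ⊤
⊤-¬WOD {n} G (C , C⊆∁⊤ , ⊤⊆Odd) = contra (trans (sym odd) even)
  where
  empty : N G zero ∩ C ≡ ⊥
  empty = Empty-unique λ (_ , x∈) →
    x∈p⇒x∉∁p ∈⊤ (C⊆∁⊤ (proj₂ (x∈p∩q⁻ (N G zero) C x∈)))

  parity : Fin _ → Bool
  parity v = does (∣ N G v ∩ C ∣ % 2 ℕ.≟ 1)

  odd : parity zero ≡ true
  odd = trans (sym (lookup∘tabulate parity zero)) ([]=⇒lookup (⊤⊆Odd {zero} ∈⊤))

  even : parity zero ≡ false
  even = cong (λ k → does (k % 2 ℕ.≟ 1)) (trans (cong ∣_∣ empty) (∣⊥∣≡0 (suc n)))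

  contra : ¬ (true ≡ false)
  contra ()

κ-isMaximum : (G : Graph n) →
  (∃ λ B → WOD G B × ∣ B ∣ ≡ κ G) × (∀ B → WOD G B → ∣ B ∣ ℕ.≤ κ G)
κ-isMaximum {n} G =
  (_ , argmax-all ∣_∣ (⊥-WOD G) (all-filter (WOD? G) (subsets n)) , refl) ,
  λ B wod → All.lookup (f[xs]≤f[argmax] {f = ∣_∣} ⊥ _) (∈-filter⁺ (WOD? G) (∈-subsets B) wod)

κ′-isMinimum : (G : Graph (suc n)) →
  (∃ λ B → ¬ WOD G B × ∣ B ∣ ≡ κ′ G) × (∀ B → ¬ WOD G B → κ′ G ℕ.≤ ∣ B ∣)
κ′-isMinimum {n} G =
  (_ , argmin-all ∣_∣ (⊤-¬WOD G) (all-filter ¬WOD? (subsets (suc n))) , refl) ,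
  λ B ¬wod → All.lookup (f[argmin]≤f[xs] {f = ∣_∣} ⊤ _) (∈-filter⁺ ¬WOD? (∈-subsets B) ¬wod)
  where
  ¬WOD? : Decidable (λ B → ¬ WOD G B)
  ¬WOD? B = ¬? (WOD? G B)

------------------------------------------------------------------------
-- Finitely supported probability distributions, as lists of weighted outcomes

Dist : Set → Set
Dist A = List (ℚ × A)

return : A → Dist A
return a = [ 1ℚ , a ]

infixl 1 _>>=_

-- Two-stage experiments: weights multiply, so the draws in a do block are
-- independent unless a later distribution mentions an earlier outcome.
_>>=_ : Dist A → (A → Dist B) → Dist B
d >>= f = concatMap (λ (p , a) → map (map₁ (p *_)) (f a)) d

Pr : Dist A → {P : A → Set} → Decidable P → ℚ
Pr d P? = foldr (λ (p , _) s → p + s) 0ℚ (filter (λ (_ , a) → P? a) d)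

fairCoin : Dist Bool
fairCoin = (½ , true) ∷ (½ , false) ∷ []

fairCoins : ∀ n → Dist (Vec Bool n)
fairCoins zero    = return []
fairCoins (suc n) = do
  b  ← fairCoin
  bs ← fairCoins n
  return (b ∷ bs)

------------------------------------------------------------------------
-- The random graph G(n, ½)

emptyGraph : Graph 0
emptyGraph = record { adj = λ () ; adj-sym = λ () ; adj-irrefl = λ () }

-- Add a new vertex zero, joined to suc v exactly when the v-th entry is true.
extend : Vec Bool n → Graph n → Graph (suc n)
extend {n} bs G = record { adj = adj⁺ ; adj-sym = sym⁺ ; adj-irrefl = irrefl⁺ }
  where
  adj⁺ : Fin (suc n) → Fin (suc n) → Bool
  adj⁺ zero    zero    = false
  adj⁺ zero    (suc v) = lookup bs v
  adj⁺ (suc u) zero    = lookup bs u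
  adj⁺ (suc u) (suc v) = adj G u v

  sym⁺ : ∀ u v → adj⁺ u v ≡ adj⁺ v u
  sym⁺ zero    zero    = refl
  sym⁺ zero    (suc v) = refl
  sym⁺ (suc u) zero    = refl
  sym⁺ (suc u) (suc v) = adj-sym G u v

  irrefl⁺ : ∀ v → adj⁺ v v ≡ false
  irrefl⁺ zero    = refl
  irrefl⁺ (suc v) = adj-irrefl G v

-- The pairs of distinct vertices of Fin (suc n) are the {zero, suc v} and the
-- {suc u, suc v} with u ≢ v, so one independent fair coin is tossed per pair.
G½ : ∀ n → Dist (Graph n)
G½ zero    = return emptyGraph
G½ (suc n) = do
  bs ← fairCoins n
  G  ← G½ n
  return (extend bs G)

module Submission where

-- Call S uniform for C if S avoids C and the vertices of S all have the same
-- parity t of neighbours in C.  A WOD set B is uniform (t odd) for its witness,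
-- and if B is not WOD then, by the Fredholm alternative over GF(2), V ∖ B is
-- uniform (t even) for some nonempty D ⊆ B; so κQ G is the size of a set uniform
-- for a nonempty C.  For fixed nonempty C the parities of the n - |C| vertices
-- outside C are independent fair bits, hence 13 ^ #{v ∉ C of parity t} has mean
-- ((13 + 1) / 2) ^ (n - |C|).  Summing over C and t bounds the total mean by
-- 2 * 8 ^ n, and Markov's inequality bounds the probability of a uniform set of
-- size at least 0.811 n by 2 * (8 / 13 ^ 0.811) ^ n, which is exponentially small
-- because 2 * 8 ^ 1000 ≤ 13 ^ 811.  The base 13 is the integer nearest to the
-- optimal one, 3 * 0.811 / 0.189.

open import Defs
open import Data.Integer.Base using (+_)
open import Data.Nat.Base as ℕ using (ℕ; NonZero)
open import Data.Product.Base using (∃)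
open import Data.Rational.Base using (_≥_; _-_; _*_; _/_; 1ℚ)
open import Data.Rational.Properties using (_<?_)

open import Algebra.Bundles using (CommutativeRing)
open import Data.Bool.Base using (Bool; true; false; not; _∧_; _xor_; if_then_else_)
open import Data.Bool.Properties
  using (xor-∧-commutativeRing; xor-same; ∧-distribˡ-xor; ∧-distribʳ-xor; ∧-assoc; ∧-comm; not-involutive; not-injective)
open import Data.Empty using (⊥-elim)
open import Data.Fin.Base using (Fin; zero; suc)
open import Data.Fin.Subset using (Subset; inside; outside; _∈_; _⊆_; ∁; _∩_; ∣_∣; Nonempty)
open import Data.Fin.Subset.Properties
  using (nonempty?; Empty-unique; ∣⊥∣≡0; ∣∁p∣≡n∸∣p∣; p∩q⊆q; x∉p⇒x∈∁p; x∈∁p⇒x∉p; p⊆q⇒∁p⊇∁q; drop-∷-⊆)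
import Data.Integer.Base as ℤ
import Data.Integer.Properties as ℤ
open import Data.List.Base using (List; []; _∷_; _++_; map; filter)
import Data.List.Membership.Propositional as List
open import Data.List.Membership.Propositional.Properties using (∈-filter⁺)
open import Data.List.Properties using (map-++; map-∘)
open import Data.List.Relation.Unary.All as All using (All; []; _∷_)
import Data.List.Relation.Unary.All.Properties as All
open import Data.List.Relation.Unary.Any using (here; there)
open import Data.Nat.Base using (zero; suc)
open import Data.Nat.Coprimality as Coprime using (1-coprimeTo)
open import Data.Nat.DivMod using (m≡m%n+[m/n]*n; m%n<n; m/n*n≤m; /-monoˡ-≤)
open import Data.Nat.ListAction using (sum)
open import Data.Nat.ListAction.Properties using (sum-++)
import Data.Nat.Properties as ℕ
open import Data.Product.Base using (_×_; _,_; proj₁; proj₂; map₁)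
open import Data.Rational.Base
  using (ℚ; mkℚ; 0ℚ; ½; _+_; -_; _≤_; _<_; *≤*; toℚᵘ; Positive; nonNegative)
open import Data.Rational.Properties
open import Data.Rational.Solver using (module +-*-Solver)
import Data.Rational.Unnormalised.Base as ℚᵘ
open ℚᵘ using (mkℚᵘ)
import Data.Rational.Unnormalised.Properties as ℚᵘ
open import Data.Sum.Base using (_⊎_; inj₁; inj₂)
open import Data.Unit.Base using (tt)
open import Data.Vec.Base using (Vec; []; _∷_; lookup; tabulate; here; there)
import Data.Vec.Functional as Vector
open import Data.Vec.Properties using ([]=⇒lookup; lookup⇒[]=; lookup∘tabulate; lookup-zipWith; lookup-map)
open import Function.Base using (_∘_; const)
open import Relation.Binary.PropositionalEquality
  using (_≡_; refl; sym; trans; cong; cong₂; subst; module ≡-Reasoning)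
open import Relation.Nullary using (¬_; Dec; does; yes; no; contradiction)
open import Relation.Unary using (Decidable)

open import Algebra.Properties.CommutativeMonoid.Sum (CommutativeRing.+-commutativeMonoid xor-∧-commutativeRing)
  using (sum-replicate-zero) renaming (sum to par; sum-cong-≗ to par-cong; ∑-distrib-+ to par-distrib-xor)
open import Algebra.Properties.CommutativeSemigroup ℕ.*-commutativeSemigroup using (interchange; x∙yz≈y∙xz)

open Graph
open +-*-Solver using (solve; _:=_; _:+_; _:*_; _:-_; con)

private
  variable
    A B I : Set
    m n   : ℕ

-- Linear algebra over GF(2)

par≡true⇒∃ : (f : Fin n → Bool) → par f ≡ true → ∃ λ i → f i ≡ true
par≡true⇒∃ {suc n} f eq with f zero in f₀
... | true  = zero , f₀
... | false with par≡true⇒∃ (f ∘ suc) eq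
...   | i , fᵢ = suc i , fᵢ

par-false : (f : Fin n → Bool) → (∀ i → f i ≡ false) → par f ≡ false
par-false {n} f eq = trans (par-cong eq) (sum-replicate-zero n)

dot : (Fin n → Bool) → (Fin n → Bool) → Bool
dot x y = par λ i → x i ∧ y i

dot-xorˡ : (x y z : Fin n → Bool) → dot (λ i → x i xor y i) z ≡ dot x z xor dot y z
dot-xorˡ x y z =
  trans (par-cong λ i → ∧-distribʳ-xor (z i) (x i) (y i)) (par-distrib-xor (λ i → x i ∧ z i) (λ i → y i ∧ z i))

dot-xorʳ : (x y z : Fin n → Bool) → dot x (λ i → y i xor z i) ≡ dot x y xor dot x z
dot-xorʳ x y z =
  trans (par-cong λ i → ∧-distribˡ-xor (x i) (y i) (z i)) (par-distrib-xor (λ i → x i ∧ y i) (λ i → x i ∧ z i))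

-- The base case of `fredholm`, a matrix without rows: a nonzero `b` is detected by a unit vector.
≗false⊎dot : (b : Fin n → Bool) → (∀ j → b j ≡ false) ⊎ (∃ λ y → dot y b ≡ true)
≗false⊎dot {zero} b = inj₁ λ ()
≗false⊎dot {suc n} b with b zero in b₀ | ≗false⊎dot (b ∘ suc)
... | true  | _             = inj₂ (true Vector.∷ (λ _ → false) , cong not (par-false {n} _ λ _ → refl))
... | false | inj₁ b≗0      = inj₁ λ { zero → b₀ ; (suc j) → b≗0 j }
... | false | inj₂ (y , yb) = inj₂ (false Vector.∷ y , yb)

-- Induction on the rows.  If y separates b from the rows after the first, but not
-- from the first, then either b xor the first row is a combination of the others,
-- or some z separates it from them, and then z or y xor z separates b from all.
fredholm : (A : Fin m → Fin n → Bool) (b : Fin n → Bool) →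
  (∃ λ x → ∀ j → dot x (λ i → A i j) ≡ b j) ⊎
  (∃ λ y → (∀ i → dot y (A i) ≡ false) × dot y b ≡ true)
fredholm {zero} A b with ≗false⊎dot b
... | inj₁ b≗0      = inj₁ ((λ ()) , λ j → sym (b≗0 j))
... | inj₂ (y , yb) = inj₂ (y , (λ ()) , yb)
fredholm {suc m} A b with fredholm (A ∘ suc) b
... | inj₁ (x , eq) = inj₁ (false Vector.∷ x , eq)
... | inj₂ (y , yA , yb) with dot y (A zero) in ya
...   | false = inj₂ (y , (λ { zero → ya ; (suc i) → yA i }) , yb)
...   | true  with fredholm (A ∘ suc) (λ j → A zero j xor b j)
...     | inj₁ (x , eq) = inj₁ (true Vector.∷ x , λ j →
            trans (cong (A zero j xor_) (eq j)) (cancel (A zero j) (b j)))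
  where
  cancel : ∀ a b → a xor (a xor b) ≡ b
  cancel true  b = not-involutive b
  cancel false b = refl
...     | inj₂ (z , zA , zab) with dot z (A zero) in za | trans (sym (dot-xorʳ z (A zero) b)) zab
...       | false | zb  = inj₂ (z , (λ { zero → za ; (suc i) → zA i }) , zb)
...       | true  | ¬zb = inj₂ ((λ j → y j xor z j) ,
            (λ { zero    → trans (dot-xorˡ y z (A zero)) (cong₂ _xor_ ya za)
               ; (suc i) → trans (dot-xorˡ y z (A (suc i))) (cong₂ _xor_ (yA i) (zA i)) }) ,
            trans (dot-xorˡ y z b) (cong₂ _xor_ yb (not-injective ¬zb)))

-- Uniform sets

odd?-suc : ∀ k → does (suc k ℕ.% 2 ℕ.≟ 1) ≡ not (does (k ℕ.% 2 ℕ.≟ 1))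
odd?-suc zero          = refl
odd?-suc (suc zero)    = refl
-- `suc (suc k) ℕ.% 2` reduces to `k ℕ.% 2`, so the recursive call has the required type as it
-- stands.
odd?-suc (suc (suc k)) = odd?-suc k

odd?-∣p∣ : (p : Subset n) → does (∣ p ∣ ℕ.% 2 ℕ.≟ 1) ≡ par (lookup p)
odd?-∣p∣ []            = refl
odd?-∣p∣ (outside ∷ p) = odd?-∣p∣ p
odd?-∣p∣ (inside  ∷ p) = trans (odd?-suc ∣ p ∣) (cong not (odd?-∣p∣ p))

-- With `C` as the first argument of `dot`, the head of `C` alone decides how this unfolds on an
-- extended graph: `inside` contributes one fresh edge by `xor`, `outside` contributes nothing.
parity : Graph n → Subset n → Fin n → Bool
parity G C v = dot (lookup C) (adj G v)

lookup-Odd : (G : Graph n) (C : Subset n) (v : Fin n) → lookup (Odd G C) v ≡ parity G C v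
lookup-Odd G C v = begin
  lookup (Odd G C) v                 ≡⟨ lookup∘tabulate _ v ⟩
  does (∣ N G v ∩ C ∣ ℕ.% 2 ℕ.≟ 1)   ≡⟨ odd?-∣p∣ (N G v ∩ C) ⟩
  par (lookup (N G v ∩ C))           ≡⟨ par-cong (λ u → trans (lookup-zipWith _∧_ u (N G v) C)
                                           (trans (cong (_∧ lookup C u) (lookup∘tabulate (adj G v) u))
                                                  (∧-comm _ (lookup C u)))) ⟩
  parity G C v                       ∎
  where open ≡-Reasoning

Uniform : Graph n → Subset n → Bool → Subset n → Set
Uniform G C t S = S ⊆ ∁ C × (∀ {v} → v ∈ S → parity G C v ≡ t)

-- Nonemptiness of `C` is essential: for empty `C` the whole vertex set would be uniform with `t`
-- equal to `false`.
UniformPair : Graph n → ℕ → Set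
UniformPair G k = ∃ λ C → Nonempty C × ∃ λ t → ∃ λ S → Uniform G C t S × ∣ S ∣ ≡ k

∣p∣>0⇒Nonempty : (p : Subset n) → 0 ℕ.< ∣ p ∣ → Nonempty p
∣p∣>0⇒Nonempty {n} p 0<∣p∣ with nonempty? p
... | yes ne = ne
... | no ¬ne = contradiction (trans (cong ∣_∣ (Empty-unique ¬ne)) (∣⊥∣≡0 n)) (ℕ.>⇒≢ 0<∣p∣)

-- A vertex of `B` has an odd number of neighbours in the witness `C`, so a nonempty `B` forces `C`
-- to be nonempty.
wod⇒uniformPair : (G : Graph n) {B : Subset n} → 0 ℕ.< ∣ B ∣ → WOD G B → UniformPair G ∣ B ∣
wod⇒uniformPair G {B} 0<∣B∣ (C , C⊆∁B , B⊆Odd) = C , nonempty , true , B , (B⊆∁C , odd) , refl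
  where
  B⊆∁C : B ⊆ ∁ C
  B⊆∁C v∈B = x∉p⇒x∈∁p λ v∈C → x∈∁p⇒x∉p (C⊆∁B v∈C) v∈B
  odd : ∀ {v} → v ∈ B → parity G C v ≡ true
  odd {v} v∈B = trans (sym (lookup-Odd G C v)) ([]=⇒lookup (B⊆Odd v∈B))
  nonempty : Nonempty C
  nonempty with ∣p∣>0⇒Nonempty B 0<∣B∣
  ... | v , v∈B with par≡true⇒∃ _ (odd v∈B)
  ... | u , eq with lookup C u in Cu
  ... | true = u , lookup⇒[]= u C Cu

¬wod⇒uniformPair : (G : Graph n) {B : Subset n} → ¬ WOD G B → UniformPair G ∣ ∁ B ∣
-- The matrix is masked to rows outside B and columns in B: a solution restricted
-- to ∁ B is then a witness C, and a dual vector restricted to B is the set D.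
¬wod⇒uniformPair {n} G {B} ¬wod with fredholm (λ u v → not (lookup B u) ∧ (lookup B v ∧ adj G v u)) (lookup B)
... | inj₁ (x , solves) = ⊥-elim (¬wod (C , C⊆∁B , B⊆Odd))
  where
  C : Subset n
  C = tabulate x ∩ ∁ B
  C⊆∁B : C ⊆ ∁ B
  C⊆∁B = p∩q⊆q (tabulate x) (∁ B)
  lookup-C : ∀ u → lookup C u ≡ x u ∧ not (lookup B u)
  lookup-C u = trans (lookup-zipWith _∧_ u (tabulate x) (∁ B))
    (cong₂ _∧_ (lookup∘tabulate x u) (lookup-map u not B))
  B⊆Odd : B ⊆ Odd G C
  B⊆Odd {v} v∈B = lookup⇒[]= v (Odd G C) (begin
    lookup (Odd G C) v
      ≡⟨ lookup-Odd G C v ⟩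
    parity G C v
      ≡⟨ par-cong (λ u → trans (cong (_∧ adj G v u) (lookup-C u)) (∧-assoc (x u) _ _)) ⟩
    dot x (λ u → not (lookup B u) ∧ adj G v u)
      ≡⟨ par-cong (λ u → cong (λ b → x u ∧ (not (lookup B u) ∧ (b ∧ adj G v u))) ([]=⇒lookup v∈B)) ⟨
    dot x (λ u → not (lookup B u) ∧ (lookup B v ∧ adj G v u))
      ≡⟨ solves v ⟩
    lookup B v
      ≡⟨ []=⇒lookup v∈B ⟩
    true ∎)
    where open ≡-Reasoning
... | inj₂ (y , orth , yB) = D , nonempty , false , ∁ B , (∁B⊆∁D , even) , refl
  where
  D : Subset n
  D = tabulate y ∩ B
  ∁B⊆∁D : ∁ B ⊆ ∁ D
  ∁B⊆∁D = p⊆q⇒∁p⊇∁q (p∩q⊆q (tabulate y) B)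
  lookup-D : ∀ u → lookup D u ≡ y u ∧ lookup B u
  lookup-D u = trans (lookup-zipWith _∧_ u (tabulate y) B)
    (cong (_∧ lookup B u) (lookup∘tabulate y u))
  nonempty : Nonempty D
  nonempty with par≡true⇒∃ _ yB
  ... | u , eq = u , lookup⇒[]= u D (trans (lookup-D u) eq)
  even : ∀ {u} → u ∈ ∁ B → parity G D u ≡ false
  even {u} u∈∁B = begin
    parity G D u
      -- The masked matrix has the entries `adj G v u`, while `parity` reads `adj G u v`; this is
      -- where the graph being undirected enters.
      ≡⟨ par-cong (λ v → trans (cong₂ _∧_ (lookup-D v) (adj-sym G u v)) (∧-assoc (y v) _ _)) ⟩
    dot y (λ v → lookup B v ∧ adj G v u)
      ≡⟨ par-cong (λ v → cong (λ b → y v ∧ (b ∧ (lookup B v ∧ adj G v u)))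
           (trans (sym (lookup-map u not B)) ([]=⇒lookup u∈∁B))) ⟨
    dot y (λ v → not (lookup B u) ∧ (lookup B v ∧ adj G v u))
      ≡⟨ orth u ⟩
    false ∎
    where open ≡-Reasoning

-- The product of `g (p v)` over the `v` outside `C`, in a recursion that matches revealing the
-- graph one vertex at a time. `g` stays arbitrary because only `g true ℕ.+ g false` enters the
-- mean.
weight : (Bool → ℕ) → Subset n → (Fin n → Bool) → ℕ
weight g []            p = 1
weight g (inside  ∷ C) p = weight g C (p ∘ suc)
weight g (outside ∷ C) p = g (p zero) ℕ.* weight g C (p ∘ suc)

gain : Bool → Bool → ℕ
gain t b = if t xor b then 1 else 13

gain-t : ∀ t → gain t t ≡ 13
gain-t t = cong (if_then 1 else 13) (xor-same t)

gain>0 : ∀ t b → 1 ℕ.≤ gain t b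
gain>0 t b with t xor b
... | true  = ℕ.s≤s ℕ.z≤n
... | false = ℕ.s≤s ℕ.z≤n

-- Every vertex of `S` supplies a factor 13, and any other vertex outside `C` a factor of at least
-- 1.
weight-≥ : ∀ t (C S : Subset n) (p : Fin n → Bool) → S ⊆ ∁ C → (∀ {v} → v ∈ S → p v ≡ t) →
  13 ℕ.^ ∣ S ∣ ℕ.≤ weight (gain t) C p
weight-≥ t [] [] p S⊆∁C p≡t = ℕ.≤-refl
weight-≥ t (inside ∷ C) (inside ∷ S) p S⊆∁C p≡t with S⊆∁C here
... | ()
weight-≥ t (inside ∷ C) (outside ∷ S) p S⊆∁C p≡t =
  weight-≥ t C S (p ∘ suc) (drop-∷-⊆ S⊆∁C) (p≡t ∘ there)
weight-≥ t (outside ∷ C) (inside ∷ S) p S⊆∁C p≡t =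
  ℕ.*-mono-≤ (ℕ.≤-reflexive (sym (trans (cong (gain t) (p≡t here)) (gain-t t))))
    (weight-≥ t C S (p ∘ suc) (drop-∷-⊆ S⊆∁C) (p≡t ∘ there))
weight-≥ t (outside ∷ C) (outside ∷ S) p S⊆∁C p≡t = begin
  13 ℕ.^ ∣ S ∣                                      ≡⟨ ℕ.*-identityˡ _ ⟨
  1 ℕ.* 13 ℕ.^ ∣ S ∣                                ≤⟨ ℕ.*-mono-≤ (gain>0 t (p zero))
                                                (weight-≥ t C S (p ∘ suc) (drop-∷-⊆ S⊆∁C) (p≡t ∘ there)) ⟩
  gain t (p zero) ℕ.* weight (gain t) C (p ∘ suc)   ∎
  where open ℕ.≤-Reasoning

-- Expectation over a finitely supported distribution

ι : ℕ → ℚ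
ι m = + m / 1

-- `_/_` divides by a gcd that is stuck for a variable `m`. The normal form exposes the numerator,
-- so that sums, products and comparisons unfold below.
ι≡mkℚ : ∀ m → ι m ≡ mkℚ (+ m) 0 (Coprime.sym (1-coprimeTo m))
ι≡mkℚ m = normalize-coprime (Coprime.sym (1-coprimeTo m))

ι-+ : ∀ m k → ι (m ℕ.+ k) ≡ ι m + ι k
ι-+ m k rewrite ι≡mkℚ m | ι≡mkℚ k =
  cong (_/ 1) (sym (cong₂ ℤ._+_ (ℤ.*-identityʳ (+ m)) (ℤ.*-identityʳ (+ k))))

ι-* : ∀ m k → ι (m ℕ.* k) ≡ ι m * ι k
ι-* m k rewrite ι≡mkℚ m | ι≡mkℚ k = cong (_/ 1) (ℤ.pos-* m k)

ι-mono-≤ : ∀ {m k} → m ℕ.≤ k → ι m ≤ ι k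
ι-mono-≤ {m} {k} m≤k rewrite ι≡mkℚ m | ι≡mkℚ k = *≤* (ℤ.*-monoʳ-≤-nonNeg (+ 1) (ℤ.+≤+ m≤k))

ι-cancel-≤ : ∀ {m k} → ι m ≤ ι k → m ℕ.≤ k
ι-cancel-≤ {m} {k} le rewrite ι≡mkℚ m | ι≡mkℚ k = ℤ.drop‿+≤+ (ℤ.*-cancelʳ-≤-pos _ _ (+ 1) (drop-*≤* le))

ι-positive : ∀ m .{{_ : NonZero m}} → Positive (ι m)
ι-positive m = normalize-pos m 1

-- The computation moves to the unnormalised rationals, where no reduction to lowest terms gets in
-- the way.
ι*1/ : ∀ n .{{_ : NonZero n}} → ι n * (+ 1 / n) ≡ 1ℚ
ι*1/ n@(suc m) = toℚᵘ-injective (begin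
  toℚᵘ (ι n * (+ 1 / n))           ≈⟨ toℚᵘ-homo-* (ι n) (+ 1 / n) ⟩
  toℚᵘ (ι n) ℚᵘ.* toℚᵘ (+ 1 / n)   ≈⟨ ℚᵘ.*-cong (toℚᵘ-fromℚᵘ (mkℚᵘ (+ n) 0)) (toℚᵘ-fromℚᵘ (mkℚᵘ (+ 1) m)) ⟩
  mkℚᵘ (+ n) 0 ℚᵘ.* mkℚᵘ (+ 1) m   ≈⟨ ℚᵘ.*-inverseʳ (mkℚᵘ (+ n) 0) ⟩
  toℚᵘ 1ℚ                          ∎)
  where open ℚᵘ.≃-Reasoning

E : Dist A → (A → ℚ) → ℚ
E []            f = 0ℚ
E ((p , a) ∷ d) f = p * f a + E d f

E-cong : (d : Dist A) {f g : A → ℚ} → (∀ a → f a ≡ g a) → E d f ≡ E d g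
E-cong []            f≗g = refl
E-cong ((p , a) ∷ d) f≗g = cong₂ (λ x y → p * x + y) (f≗g a) (E-cong d f≗g)

E-++ : (d e : Dist A) (f : A → ℚ) → E (d ++ e) f ≡ E d f + E e f
E-++ []            e f = sym (+-identityˡ _)
E-++ ((p , a) ∷ d) e f = trans (cong (λ x → p * f a + x) (E-++ d e f)) (sym (+-assoc (p * f a) (E d f) (E e f)))

E-scale : ∀ p (d : Dist A) (f : A → ℚ) → E (map (map₁ (p *_)) d) f ≡ p * E d f
E-scale p []            f = sym (*-zeroʳ p)
E-scale p ((q , a) ∷ d) f =
  trans (cong₂ _+_ (*-assoc p q (f a)) (E-scale p d f)) (sym (*-distribˡ-+ p (q * f a) (E d f)))

E->>= : (d : Dist A) (k : A → Dist B) (f : B → ℚ) → E (d >>= k) f ≡ E d (λ a → E (k a) f)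
E->>= []            k f = refl
E->>= ((p , a) ∷ d) k f =
  trans (E-++ (map (map₁ (p *_)) (k a)) (d >>= k) f) (cong₂ _+_ (E-scale p (k a) f) (E->>= d k f))

E-return : (a : A) (f : A → ℚ) → E (return a) f ≡ f a
E-return a f = trans (+-identityʳ (1ℚ * f a)) (*-identityˡ (f a))

E->>=-return : (d : Dist A) (h : A → B) (f : B → ℚ) → E (d >>= λ a → return (h a)) f ≡ E d (f ∘ h)
E->>=-return d h f = trans (E->>= d (λ a → return (h a)) f) (E-cong d λ a → E-return (h a) f)

E-+ : (d : Dist A) (f g : A → ℚ) → E d (λ a → f a + g a) ≡ E d f + E d g
E-+ []            f g = refl
E-+ ((p , a) ∷ d) f g = trans (cong (λ x → p * (f a + g a) + x) (E-+ d f g))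
  (solve 5 (λ p x y u v → p :* (x :+ y) :+ (u :+ v) := (p :* x :+ u) :+ (p :* y :+ v))
    refl p (f a) (g a) (E d f) (E d g))

E-*ˡ : ∀ c (d : Dist A) (f : A → ℚ) → E d (λ a → c * f a) ≡ c * E d f
E-*ˡ c []            f = sym (*-zeroʳ c)
E-*ˡ c ((p , a) ∷ d) f = trans (cong (λ x → p * (c * f a) + x) (E-*ˡ c d f))
  (solve 4 (λ p c x u → p :* (c :* x) :+ c :* u := c :* (p :* x :+ u)) refl p c (f a) (E d f))

E-zero : (d : Dist A) → E d (const 0ℚ) ≡ 0ℚ
E-zero []            = refl
E-zero ((p , a) ∷ d) = cong₂ _+_ (*-zeroʳ p) (E-zero d)

-- Fubini for two independent draws. It allows the coins of a new vertex to be averaged first, with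
-- the older graph fixed.
E-comm : (d : Dist A) (e : Dist B) (f : A → B → ℚ) →
  E d (λ a → E e (f a)) ≡ E e (λ b → E d (λ a → f a b))
E-comm []            e f = sym (E-zero e)
E-comm ((p , a) ∷ d) e f = begin
  p * E e (f a) + E d (λ a → E e (f a))                   ≡⟨ cong₂ _+_ (sym (E-*ˡ p e (f a))) (E-comm d e f) ⟩
  E e (λ b → p * f a b) + E e (λ b → E d (λ a → f a b))   ≡⟨ E-+ e _ _ ⟨
  E e (λ b → p * f a b + E d (λ a → f a b))               ∎
  where open ≡-Reasoning

-- Probability distributions and Markov's inequality.

NonNegWeights : Dist A → Set
NonNegWeights = All (λ (p , _) → 0ℚ ≤ p)

nonNeg-* : ∀ {p q} → 0ℚ ≤ p → 0ℚ ≤ q → 0ℚ ≤ p * q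
nonNeg-* {p} {q} 0≤p 0≤q = nonNegative⁻¹ (p * q)
  {{nonNeg*nonNeg⇒nonNeg p {{nonNegative 0≤p}} q {{nonNegative 0≤q}}}}

nonNeg->>= : {d : Dist A} {k : A → Dist B} → NonNegWeights d → (∀ a → NonNegWeights (k a)) → NonNegWeights (d >>= k)
nonNeg->>= []           nnk = []
nonNeg->>= {d = (p , a) ∷ d} (0≤p ∷ nnd) nnk =
  All.++⁺ (All.map⁺ (All.map (nonNeg-* 0≤p) (nnk a))) (nonNeg->>= nnd nnk)

nonNeg-return : (a : A) → NonNegWeights (return a)
nonNeg-return a = nonNegative⁻¹ 1ℚ ∷ []

E-mono-≤ : {d : Dist A} → NonNegWeights d → {f g : A → ℚ} → (∀ a → f a ≤ g a) → E d f ≤ E d g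
E-mono-≤ []                                f≤g = ≤-refl
E-mono-≤ {d = (p , a) ∷ d} (0≤p ∷ nnd) f≤g =
  +-mono-≤ (*-monoˡ-≤-nonNeg p {{nonNegative 0≤p}} (f≤g a)) (E-mono-≤ nnd f≤g)

indicator : {P : Set} → Dec P → ℚ
indicator P? = if does P? then 1ℚ else 0ℚ

Pr≡E : (d : Dist A) {P : A → Set} (P? : Decidable P) → Pr d P? ≡ E d (λ a → indicator (P? a))
Pr≡E []            P? = refl
Pr≡E ((p , a) ∷ d) P? with does (P? a)
... | true  = cong₂ _+_ (sym (*-identityʳ p)) (Pr≡E d P?)
... | false = trans (Pr≡E d P?) (trans (sym (+-identityˡ _)) (cong (_+ _) (sym (*-zeroʳ p))))

IsProbability : Dist A → Set
IsProbability d = NonNegWeights d × E d (const 1ℚ) ≡ 1ℚ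

E-const : {d : Dist A} → IsProbability d → ∀ c → E d (const c) ≡ c
E-const {d = d} (_ , total) c = begin
  E d (const c)          ≡⟨ E-cong d (λ _ → sym (*-identityʳ c)) ⟩
  E d (const (c * 1ℚ))   ≡⟨ E-*ˡ c d (const 1ℚ) ⟩
  c * E d (const 1ℚ)     ≡⟨ cong (c *_) total ⟩
  c * 1ℚ                 ≡⟨ *-identityʳ c ⟩
  c                      ∎
  where open ≡-Reasoning

isProbability->>= : {d : Dist A} {k : A → Dist B} →
  IsProbability d → (∀ a → IsProbability (k a)) → IsProbability (d >>= k)
isProbability->>= {d = d} {k} (nnd , total) pk =
  nonNeg->>= nnd (proj₁ ∘ pk) ,
  trans (E->>= d k (const 1ℚ)) (trans (E-cong d (proj₂ ∘ pk)) total)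

isProbability-return : (a : A) → IsProbability (return a)
isProbability-return a = nonNeg-return a , refl

isProbability-fairCoin : IsProbability fairCoin
isProbability-fairCoin = (nonNegative⁻¹ ½ ∷ nonNegative⁻¹ ½ ∷ []) , refl

isProbability-fairCoins : ∀ n → IsProbability (fairCoins n)
isProbability-fairCoins zero    = isProbability-return _
isProbability-fairCoins (suc n) =
  isProbability->>= isProbability-fairCoin λ b →
  isProbability->>= (isProbability-fairCoins n) λ bs → isProbability-return (b ∷ bs)

isProbability-G½ : ∀ n → IsProbability (G½ n)
isProbability-G½ zero    = isProbability-return _
isProbability-G½ (suc n) =
  isProbability->>= (isProbability-fairCoins n) λ bs →
  isProbability->>= (isProbability-G½ n) λ G → isProbability-return (extend bs G)

-- Markov's inequality for the failure of `P`, free of division: pointwise, `ι T` is covered by the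
-- indicator term where `P` holds and by `f` where it fails.
markov : {d : Dist A} → IsProbability d → {P : A → Set} (P? : Decidable P) (f : A → ℕ) (T : ℕ) →
  (∀ a → ¬ P a → T ℕ.≤ f a) → ι T ≤ ι T * Pr d P? + E d (ι ∘ f)
markov {d = d} prob@(nn , _) P? f T T≤f = begin
  ι T                                                ≡⟨ E-const prob (ι T) ⟨
  E d (const (ι T))                                  ≤⟨ E-mono-≤ nn pointwise ⟩
  E d (λ a → ι T * indicator (P? a) + ι (f a))       ≡⟨ E-+ d _ _ ⟩
  E d (λ a → ι T * indicator (P? a)) + E d (ι ∘ f)   ≡⟨ cong (_+ E d (ι ∘ f)) (E-*ˡ (ι T) d _) ⟩
  ι T * E d (λ a → indicator (P? a)) + E d (ι ∘ f)   ≡⟨ cong (λ x → ι T * x + E d (ι ∘ f)) (Pr≡E d P?) ⟨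
  ι T * Pr d P? + E d (ι ∘ f)                        ∎
  where
  open ≤-Reasoning
  pointwise : ∀ a → ι T ≤ ι T * indicator (P? a) + ι (f a)
  pointwise a with P? a
  ... | yes _  = begin
    ι T                  ≡⟨ trans (+-identityʳ _) (*-identityʳ (ι T)) ⟨
    ι T * 1ℚ + 0ℚ        ≤⟨ +-monoʳ-≤ (ι T * 1ℚ) (ι-mono-≤ {0} {f a} ℕ.z≤n) ⟩
    ι T * 1ℚ + ι (f a)   ∎
  ... | no ¬Pa = begin
    ι T                  ≤⟨ ι-mono-≤ (T≤f a ¬Pa) ⟩
    ι (f a)              ≡⟨ trans (cong (_+ ι (f a)) (*-zeroʳ (ι T))) (+-identityˡ _) ⟨
    ι T * 0ℚ + ι (f a)   ∎

-- A threshold `n ℕ.* M` against a mean of at most `M` leaves failure probability at most `1 / n`.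
-- The inequality is proved multiplied by `n ℕ.* M`.
markov-1/n : {d : Dist A} → IsProbability d → {P : A → Set} (P? : Decidable P) (f : A → ℕ)
  (n M : ℕ) .{{_ : NonZero n}} .{{M≢0 : NonZero M}} →
  (∀ a → ¬ P a → n ℕ.* M ℕ.≤ f a) → E d (ι ∘ f) ≤ ι M → Pr d P? ≥ 1ℚ - (+ 1 / n)
markov-1/n {d = d} prob P? f n M nM≤f Ef≤M =
  *-cancelˡ-≤-pos (ι (n ℕ.* M)) {{ι-positive (n ℕ.* M) {{ℕ.m*n≢0 n M}}}} (begin
  t * (1ℚ - u)                      ≡⟨ solve 2 (λ t u → t :* (con 1ℚ :- u) := t :- t :* u) refl t u ⟩
  t - t * u                         ≡⟨ cong (λ x → t - x) tu ⟩
  t - ι M                           ≤⟨ +-monoˡ-≤ (- ι M) (markov prob P? f (n ℕ.* M) nM≤f) ⟩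
  t * Pr d P? + E d (ι ∘ f) - ι M   ≤⟨ +-monoˡ-≤ (- ι M) (+-monoʳ-≤ (t * Pr d P?) Ef≤M) ⟩
  t * Pr d P? + ι M - ι M           ≡⟨ solve 2 (λ x y → x :+ y :- y := x) refl (t * Pr d P?) (ι M) ⟩
  t * Pr d P?                       ∎)
  where
  open ≤-Reasoning
  t = ι (n ℕ.* M)
  u = + 1 / n
  tu : t * u ≡ ι M
  tu = trans (cong (_* u) (ι-* n M))
    (trans (solve 3 (λ x y z → x :* y :* z := x :* z :* y) refl (ι n) (ι M) u)
      (trans (cong (_* ι M) (ι*1/ n)) (*-identityˡ (ι M))))

-- Linearity of expectation. The means are required only for members of `cs`, since `E-weight`
-- provides them only for nonempty sets.
E-sum : (d : Dist A) (w : I → A → ℕ) (h : I → ℕ) {cs : List I} →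
  All (λ c → E d (ι ∘ w c) ≡ ι (h c)) cs →
  E d (λ a → ι (sum (map (λ c → w c a) cs))) ≡ ι (sum (map h cs))
E-sum d w h []                   = E-zero d
E-sum d w h {c ∷ cs} (eq ∷ eqs) = begin
  E d (λ a → ι (w c a ℕ.+ sum (map (λ c → w c a) cs)))         ≡⟨ E-cong d (λ a → ι-+ (w c a) _) ⟩
  E d (λ a → ι (w c a) + ι (sum (map (λ c → w c a) cs)))       ≡⟨ E-+ d _ _ ⟩
  E d (ι ∘ w c) + E d (λ a → ι (sum (map (λ c → w c a) cs)))   ≡⟨ cong₂ _+_ eq (E-sum d w h eqs) ⟩
  ι (h c) + ι (sum (map h cs))                                 ≡⟨ ι-+ (h c) _ ⟨
  ι (h c ℕ.+ sum (map h cs))                                   ∎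
  where open ≡-Reasoning

E-fairCoins-suc : ∀ n (f : Vec Bool (suc n) → ℚ) →
  E (fairCoins (suc n)) f ≡ ½ * (E (fairCoins n) (f ∘ (true ∷_)) + E (fairCoins n) (f ∘ (false ∷_)))
E-fairCoins-suc n f = begin
  E (fairCoins (suc n)) f                ≡⟨ E->>= fairCoin rest f ⟩
  ½ * E (rest true) f + (½ * E (rest false) f + 0ℚ)
    ≡⟨ cong₂ (λ x y → ½ * x + (½ * y + 0ℚ)) (E->>=-return (fairCoins n) _ f) (E->>=-return (fairCoins n) _ f) ⟩
  ½ * x + (½ * y + 0ℚ)
    ≡⟨ solve 2 (λ x y → con ½ :* x :+ (con ½ :* y :+ con 0ℚ) := con ½ :* (x :+ y)) refl x y ⟩
  ½ * (x + y)                            ∎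
  where
  open ≡-Reasoning
  rest : Bool → Dist (Vec Bool (suc n))
  rest b = fairCoins n >>= λ bs → return (b ∷ bs)
  x = E (fairCoins n) (f ∘ (true ∷_))
  y = E (fairCoins n) (f ∘ (false ∷_))

E-G½-suc : ∀ n (f : Graph (suc n) → ℚ) →
  E (G½ (suc n)) f ≡ E (fairCoins n) (λ bs → E (G½ n) (λ G → f (extend bs G)))
E-G½-suc n f = trans (E->>= (fairCoins n) (λ bs → G½ n >>= λ G → return (extend bs G)) f)
  (E-cong (fairCoins n) λ bs → E->>=-return (G½ n) (extend bs) f)

-- The expected weight of a random graph

½*ι[2*c]≡ι[c] : ∀ c → ½ * ι (2 ℕ.* c) ≡ ι c
½*ι[2*c]≡ι[c] c = begin
  ½ * ι (2 ℕ.* c)   ≡⟨ cong (½ *_) (ι-* 2 c) ⟩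
  ½ * (ι 2 * ι c)   ≡⟨ *-assoc ½ (ι 2) (ι c) ⟨
  1ℚ * ι c          ≡⟨ *-identityˡ (ι c) ⟩
  ι c               ∎
  where open ≡-Reasoning

average : ∀ a b c x → a ℕ.+ b ≡ 2 ℕ.* c → ½ * (ι a * x + ι b * x) ≡ ι c * x
average a b c x a+b = begin
  ½ * (ι a * x + ι b * x)
    ≡⟨ solve 3 (λ p q x → con ½ :* (p :* x :+ q :* x) := con ½ :* (p :+ q) :* x) refl (ι a) (ι b) x ⟩
  ½ * (ι a + ι b) * x
    ≡⟨ cong (λ y → ½ * y * x) (trans (sym (ι-+ a b)) (cong ι a+b)) ⟩
  ½ * ι (2 ℕ.* c) * x
    ≡⟨ cong (_* x) (½*ι[2*c]≡ι[c] c) ⟩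
  ι c * x ∎
  where open ≡-Reasoning

E-ι* : (d : Dist A) (c : ℕ) (f : A → ℕ) → E d (λ a → ι (c ℕ.* f a)) ≡ ι c * E d (ι ∘ f)
E-ι* d c f = trans (E-cong d λ a → ι-* c (f a)) (E-*ˡ (ι c) d (ι ∘ f))

½*[x+x]≡x : ∀ x → ½ * (x + x) ≡ x
½*[x+x]≡x = solve 1 (λ x → con ½ :* (x :+ x) := x) refl

-- Shifting by `q` permutes the two bits: a fair bit stays fair after `xor` with a constant.
sum-xor : ∀ (g : Bool → ℕ) {s} → g true ℕ.+ g false ≡ s → ∀ q → g (true xor q) ℕ.+ g (false xor q) ≡ s
sum-xor g eq true  = trans (ℕ.+-comm (g false) (g true)) eq
sum-xor g eq false = eq

-- For a new vertex in `C`: each older vertex has its own fresh coin towards it, `q` being the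
-- parity it had before. So the factors outside `C` are independent, each of mean `c`.
E-weight-coins : ∀ (g : Bool → ℕ) c → g true ℕ.+ g false ≡ 2 ℕ.* c → (C : Subset n) (q : Fin n → Bool) →
  E (fairCoins n) (λ bs → ι (weight g C (λ v → lookup bs v xor q v))) ≡ ι (c ℕ.^ ∣ ∁ C ∣)
E-weight-coins g c eq [] q = refl
E-weight-coins {suc n} g c eq (inside ∷ C) q = begin
  E (fairCoins (suc n)) (λ bs → ι (weight g (inside ∷ C) (λ v → lookup bs v xor q v)))
    ≡⟨ E-fairCoins-suc n _ ⟩
  -- This vertex lies in `C`, so `weight` ignores its coin and both halves coincide.
  ½ * (x + x)
    ≡⟨ ½*[x+x]≡x x ⟩
  x
    ≡⟨ E-weight-coins g c eq C (q ∘ suc) ⟩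
  ι (c ℕ.^ ∣ ∁ C ∣) ∎
  where
  open ≡-Reasoning
  x = E (fairCoins n) (λ bs → ι (weight g C (λ v → lookup bs v xor q (suc v))))
E-weight-coins {suc n} g c eq (outside ∷ C) q = begin
  E (fairCoins (suc n)) (λ bs → ι (weight g (outside ∷ C) (λ v → lookup bs v xor q v)))
    ≡⟨ E-fairCoins-suc n _ ⟩
  ½ * (E (fairCoins n) (λ bs → ι (t ℕ.* w bs)) + E (fairCoins n) (λ bs → ι (f ℕ.* w bs)))
    ≡⟨ cong₂ (λ x y → ½ * (x + y)) (E-ι* (fairCoins n) t w) (E-ι* (fairCoins n) f w) ⟩
  ½ * (ι t * x + ι f * x)
    ≡⟨ average t f c x (sum-xor g eq (q zero)) ⟩
  ι c * x
    ≡⟨ cong (ι c *_) (E-weight-coins g c eq C (q ∘ suc)) ⟩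
  ι c * ι (c ℕ.^ ∣ ∁ C ∣)
    ≡⟨ ι-* c (c ℕ.^ ∣ ∁ C ∣) ⟨
  ι (c ℕ.^ ∣ ∁ (outside ∷ C) ∣) ∎
  where
  open ≡-Reasoning
  t = g (true xor q zero)
  f = g (false xor q zero)
  w = λ bs → weight g C (λ v → lookup bs v xor q (suc v))
  x = E (fairCoins n) (ι ∘ w)

-- For a new vertex outside `C`: its parity is the `xor` of its coins towards `C`, and one fair coin
-- among them makes it fair. Hence `C` must be nonempty.
E-dot-coins : ∀ (g : Bool → ℕ) c → g true ℕ.+ g false ≡ 2 ℕ.* c → (C : Subset n) → Nonempty C →
  E (fairCoins n) (λ bs → ι (g (dot (lookup C) (lookup bs)))) ≡ ι c
E-dot-coins {suc n} g c eq (inside ∷ C) _ = begin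
  E (fairCoins (suc n)) (λ bs → ι (g (dot (lookup (inside ∷ C)) (lookup bs))))
    ≡⟨ E-fairCoins-suc n _ ⟩
  ½ * (E (fairCoins n) (λ bs → ι (g (not (d bs)))) + E (fairCoins n) (λ bs → ι (g (d bs))))
    -- Flipping the first coin flips the parity, so each outcome of the other coins meets both
    -- values of `g` once.
    ≡⟨ cong (½ *_) (E-+ (fairCoins n) _ _) ⟨
  ½ * E (fairCoins n) (λ bs → ι (g (not (d bs))) + ι (g (d bs)))
    ≡⟨ cong (½ *_) (E-cong (fairCoins n) λ bs →
         trans (sym (ι-+ (g (not (d bs))) _)) (cong ι (sum-xor g eq (d bs)))) ⟩
  ½ * E (fairCoins n) (const (ι (2 ℕ.* c)))
    ≡⟨ cong (½ *_) (E-const (isProbability-fairCoins n) (ι (2 ℕ.* c))) ⟩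
  ½ * ι (2 ℕ.* c)
    ≡⟨ ½*ι[2*c]≡ι[c] c ⟩
  ι c ∎
  where
  open ≡-Reasoning
  d = λ bs → dot (lookup C) (lookup bs)
E-dot-coins {suc n} g c eq (outside ∷ C) (suc v , there v∈C) = begin
  E (fairCoins (suc n)) (λ bs → ι (g (dot (lookup (outside ∷ C)) (lookup bs))))
    ≡⟨ E-fairCoins-suc n _ ⟩
  ½ * (x + x)
    ≡⟨ ½*[x+x]≡x x ⟩
  x
    ≡⟨ E-dot-coins g c eq C (v , v∈C) ⟩
  ι c ∎
  where
  open ≡-Reasoning
  x = E (fairCoins n) (λ bs → ι (g (dot (lookup C) (lookup bs))))

-- If the new vertex is in `C`, its coins alone randomise all parities outside `C`, whatever the
-- older graph. Otherwise they determine only its own parity, which is independent of the older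
-- graph, and the mean factors.
E-weight : ∀ (g : Bool → ℕ) c → g true ℕ.+ g false ≡ 2 ℕ.* c → (C : Subset n) → Nonempty C →
  E (G½ n) (λ G → ι (weight g C (parity G C))) ≡ ι (c ℕ.^ ∣ ∁ C ∣)
E-weight {suc n} g c eq (inside ∷ C) _ = begin
  E (G½ (suc n)) (λ G → ι (weight g (inside ∷ C) (parity G (inside ∷ C))))
    ≡⟨ E-G½-suc n _ ⟩
  E (fairCoins n) (λ bs → E (G½ n) λ G → ι (weight g C (λ v → lookup bs v xor parity G C v)))
    ≡⟨ E-comm (fairCoins n) (G½ n) _ ⟩
  E (G½ n) (λ G → E (fairCoins n) λ bs → ι (weight g C (λ v → lookup bs v xor parity G C v)))
    ≡⟨ E-cong (G½ n) (λ G → E-weight-coins g c eq C (parity G C)) ⟩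
  E (G½ n) (const (ι (c ℕ.^ ∣ ∁ C ∣)))
    ≡⟨ E-const (isProbability-G½ n) _ ⟩
  ι (c ℕ.^ ∣ ∁ C ∣) ∎
  where open ≡-Reasoning
E-weight {suc n} g c eq (outside ∷ C) (suc v , there v∈C) = begin
  E (G½ (suc n)) (λ G → ι (weight g (outside ∷ C) (parity G (outside ∷ C))))
    ≡⟨ E-G½-suc n _ ⟩
  E (fairCoins n) (λ bs → E (G½ n) λ G → ι (r bs ℕ.* w G))
    ≡⟨ E-cong (fairCoins n) (λ bs → trans (E-ι* (G½ n) (r bs) w) (*-comm (ι (r bs)) x)) ⟩
  E (fairCoins n) (λ bs → x * ι (r bs))
    ≡⟨ E-*ˡ x (fairCoins n) (ι ∘ r) ⟩
  x * E (fairCoins n) (ι ∘ r)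
    ≡⟨ cong₂ _*_ (E-weight g c eq C (v , v∈C)) (E-dot-coins g c eq C (v , v∈C)) ⟩
  ι (c ℕ.^ ∣ ∁ C ∣) * ι c
    ≡⟨ *-comm (ι (c ℕ.^ ∣ ∁ C ∣)) (ι c) ⟩
  ι c * ι (c ℕ.^ ∣ ∁ C ∣)
    ≡⟨ ι-* c (c ℕ.^ ∣ ∁ C ∣) ⟨
  ι (c ℕ.^ ∣ ∁ (outside ∷ C) ∣) ∎
  where
  open ≡-Reasoning
  r = λ bs → g (dot (lookup C) (lookup bs))
  w = λ G → weight g C (parity G C)
  x = E (G½ n) (ι ∘ w)

-- Summation over all nonempty `C`.

nonemptySubsets : ∀ n → List (Subset n)
nonemptySubsets n = filter nonempty? (subsets n)

sum-filter-≤ : {P : A → Set} (P? : Decidable P) (h : A → ℕ) (xs : List A) →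
  sum (map h (filter P? xs)) ℕ.≤ sum (map h xs)
sum-filter-≤ P? h [] = ℕ.≤-refl
sum-filter-≤ P? h (x ∷ xs) with does (P? x)
... | true  = ℕ.+-monoʳ-≤ (h x) (sum-filter-≤ P? h xs)
... | false = ℕ.≤-trans (sum-filter-≤ P? h xs) (ℕ.m≤n+m _ (h x))

∈⇒≤sum : (h : A → ℕ) {x : A} {xs : List A} → x List.∈ xs → h x ℕ.≤ sum (map h xs)
∈⇒≤sum h (here refl) = ℕ.m≤m+n _ _
∈⇒≤sum h (there x∈)  = ℕ.≤-trans (∈⇒≤sum h x∈) (ℕ.m≤n+m _ _)

sum-map-* : (c : ℕ) (h : A → ℕ) (xs : List A) → sum (map (λ x → c ℕ.* h x) xs) ≡ c ℕ.* sum (map h xs)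
sum-map-* c h []       = sym (ℕ.*-zeroʳ c)
sum-map-* c h (x ∷ xs) = trans (cong (c ℕ.* h x ℕ.+_) (sum-map-* c h xs)) (sym (ℕ.*-distribˡ-+ c (h x) _))

-- The binomial theorem, one vertex at a time: putting it into `C` contributes 1, leaving it out
-- contributes `c`.
sum-subsets : ∀ c n → sum (map (λ C → c ℕ.^ ∣ ∁ C ∣) (subsets n)) ≡ suc c ℕ.^ n
sum-subsets c zero    = refl
sum-subsets c (suc n) = begin
  sum (map h (map (inside ∷_) xs ++ map (outside ∷_) xs))
    ≡⟨ cong sum (map-++ h (map (inside ∷_) xs) (map (outside ∷_) xs)) ⟩
  sum (map h (map (inside ∷_) xs) ++ map h (map (outside ∷_) xs))
    ≡⟨ sum-++ (map h (map (inside ∷_) xs)) _ ⟩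
  sum (map h (map (inside ∷_) xs)) ℕ.+ sum (map h (map (outside ∷_) xs))
    ≡⟨ cong₂ (λ as bs → sum as ℕ.+ sum bs) (map-∘ xs) (map-∘ xs) ⟨
  sum (map (λ C → c ℕ.^ ∣ ∁ C ∣) xs) ℕ.+ sum (map (λ C → c ℕ.* c ℕ.^ ∣ ∁ C ∣) xs)
    ≡⟨ cong (sum (map (λ C → c ℕ.^ ∣ ∁ C ∣) xs) ℕ.+_) (sum-map-* c (λ C → c ℕ.^ ∣ ∁ C ∣) xs) ⟩
  suc c ℕ.* sum (map (λ C → c ℕ.^ ∣ ∁ C ∣) xs)
    ≡⟨ cong (suc c ℕ.*_) (sum-subsets c n) ⟩
  suc c ℕ.^ suc n ∎
  where
  open ≡-Reasoning
  xs = subsets n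
  h : Subset (suc n) → ℕ
  h C = c ℕ.^ ∣ ∁ C ∣

gain-sum : ∀ t → gain t true ℕ.+ gain t false ≡ 2 ℕ.* 7
gain-sum true  = refl
gain-sum false = refl

totalWeight : Bool → Graph n → ℕ
totalWeight {n} t G = sum (map (λ C → weight (gain t) C (parity G C)) (nonemptySubsets n))

E-totalWeight : ∀ t n → E (G½ n) (ι ∘ totalWeight t) ≤ ι (8 ℕ.^ n)
E-totalWeight t n = begin
  E (G½ n) (ι ∘ totalWeight t)
    ≡⟨ E-sum (G½ n) (λ C G → weight (gain t) C (parity G C)) (λ C → 7 ℕ.^ ∣ ∁ C ∣)
         (All.map (λ {C} → E-weight (gain t) 7 (gain-sum t) C) (All.all-filter nonempty? (subsets n))) ⟩
  ι (sum (map (λ C → 7 ℕ.^ ∣ ∁ C ∣) (nonemptySubsets n)))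
    -- Putting the empty set back only enlarges the sum and completes the binomial expansion.
    ≤⟨ ι-mono-≤ (ℕ.≤-trans (sum-filter-≤ nonempty? _ (subsets n)) (ℕ.≤-reflexive (sum-subsets 7 n))) ⟩
  ι (8 ℕ.^ n) ∎
  where open ≤-Reasoning

-- One random quantity for both halves of `κQ`: odd parity handles `κ`, even parity handles `κ′`.
deviation : Graph n → ℕ
deviation G = totalWeight true G ℕ.+ totalWeight false G

E-deviation : ∀ n → E (G½ n) (ι ∘ deviation) ≤ ι (2 ℕ.* 8 ℕ.^ n)
E-deviation n = begin
  E (G½ n) (ι ∘ deviation)
    ≡⟨ E-cong (G½ n) (λ G → ι-+ (totalWeight true G) _) ⟩
  E (G½ n) (λ G → ι (totalWeight true G) + ι (totalWeight false G))
    ≡⟨ E-+ (G½ n) _ _ ⟩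
  E (G½ n) (ι ∘ totalWeight true) + E (G½ n) (ι ∘ totalWeight false)
    ≤⟨ +-mono-≤ (E-totalWeight true n) (E-totalWeight false n) ⟩
  ι (8 ℕ.^ n) + ι (8 ℕ.^ n)
    ≡⟨ ι-+ (8 ℕ.^ n) (8 ℕ.^ n) ⟨
  ι (8 ℕ.^ n ℕ.+ 8 ℕ.^ n)
    ≡⟨ cong (λ m → ι (8 ℕ.^ n ℕ.+ m)) (ℕ.+-identityʳ (8 ℕ.^ n)) ⟨
  ι (2 ℕ.* 8 ℕ.^ n) ∎
  where open ≤-Reasoning

totalWeight≤deviation : ∀ t (G : Graph n) → totalWeight t G ℕ.≤ deviation G
totalWeight≤deviation true  G = ℕ.m≤m+n _ _
totalWeight≤deviation false G = ℕ.m≤n+m _ _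

uniformPair⇒deviation : (G : Graph n) {k : ℕ} → UniformPair G k → 13 ℕ.^ k ℕ.≤ deviation G
uniformPair⇒deviation {n} G (C , ne , t , S , (S⊆∁C , uniform) , refl) = begin
  13 ℕ.^ ∣ S ∣                     ≤⟨ weight-≥ t C S (parity G C) S⊆∁C uniform ⟩
  weight (gain t) C (parity G C)   ≤⟨ ∈⇒≤sum _ (∈-filter⁺ nonempty? (∈-subsets C) ne) ⟩
  totalWeight t G                  ≤⟨ totalWeight≤deviation t G ⟩
  deviation G                      ∎
  where open ℕ.≤-Reasoning

-- From `κQ` to uniform sets.

κ-uniformPair : (G : Graph n) → 0 ℕ.< κ G → UniformPair G (κ G)
κ-uniformPair G 0<κ with proj₁ (κ-isMaximum G)
... | B , wod , ∣B∣≡κ =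
  subst (UniformPair G) ∣B∣≡κ (wod⇒uniformPair G (subst (0 ℕ.<_) (sym ∣B∣≡κ) 0<κ) wod)

-- Applied to the complement of a smallest non-WOD set, which exists because there is at least one
-- vertex.
κ′-uniformPair : (G : Graph (suc n)) → UniformPair G (suc n ℕ.∸ κ′ G)
κ′-uniformPair {n} G with proj₁ (κ′-isMinimum G)
... | B , ¬wod , ∣B∣≡κ′ =
  subst (UniformPair G) (trans (∣∁p∣≡n∸∣p∣ B) (cong (suc n ℕ.∸_) ∣B∣≡κ′)) (¬wod⇒uniformPair G ¬wod)

κQ-uniformPair : (G : Graph (suc n)) → 0 ℕ.< κQ G → UniformPair G (κQ G)
κQ-uniformPair {n} G 0<κQ with ℕ.⊔-sel (κ G) (suc n ℕ.∸ κ′ G)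
... | inj₁ eq = subst (UniformPair G) (sym eq) (κ-uniformPair G (subst (0 ℕ.<_) eq 0<κQ))
... | inj₂ eq = subst (UniformPair G) (sym eq) (κ′-uniformPair G)

-- Numerical estimates

^-cancelˡ-≤ : ∀ k .{{_ : NonZero k}} {a b} → a ℕ.^ k ℕ.≤ b ℕ.^ k → a ℕ.≤ b
^-cancelˡ-≤ k le = ℕ.≮⇒≥ λ b<a → ℕ.<⇒≱ (ℕ.^-monoˡ-< k b<a) le

^-distribʳ-* : ∀ a b k → (a ℕ.* b) ℕ.^ k ≡ a ℕ.^ k ℕ.* b ℕ.^ k
^-distribʳ-* a b zero = refl
^-distribʳ-* a b (suc k) = trans (cong (a ℕ.* b ℕ.*_) (^-distribʳ-* a b k)) (interchange a b (a ℕ.^ k) (b ℕ.^ k))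

^-comm : ∀ a k l → (a ℕ.^ k) ℕ.^ l ≡ (a ℕ.^ l) ℕ.^ k
^-comm a k l = trans (ℕ.^-*-assoc a k l) (trans (cong (a ℕ.^_) (ℕ.*-comm k l)) (sym (ℕ.^-*-assoc a l k)))

-- This just holds, with about four percent to spare, and is checked by evaluating both numbers. In
-- the `n`-th power, the factor 2 leaves a `2 ℕ.^ n` that absorbs all polynomial losses.
2*8^1000≤13^811 : 2 ℕ.* 8 ℕ.^ 1000 ℕ.≤ 13 ℕ.^ 811
2*8^1000≤13^811 = ℕ.≤ᵇ⇒≤ (2 ℕ.* 8 ℕ.^ 1000) (13 ℕ.^ 811) tt

-- One more step doubles the right side but adds only 2000 to the left. The start 15 is the least
-- `q` with `2000 ℕ.* suc q ℕ.≤ 2 ℕ.^ q`, whence the threshold 15000.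
2000*[16+d]≤2^[15+d] : ∀ d → 2000 ℕ.* (16 ℕ.+ d) ℕ.≤ 2 ℕ.^ (15 ℕ.+ d)
2000*[16+d]≤2^[15+d] zero = ℕ.≤ᵇ⇒≤ 32000 32768 tt
2000*[16+d]≤2^[15+d] (suc d) = begin
  2000 ℕ.* (16 ℕ.+ suc d)                       ≡⟨ cong (2000 ℕ.*_) (ℕ.+-suc 16 d) ⟩
  2000 ℕ.* suc (16 ℕ.+ d)                       ≡⟨ ℕ.*-suc 2000 (16 ℕ.+ d) ⟩
  2000 ℕ.+ 2000 ℕ.* (16 ℕ.+ d)                  ≤⟨ ℕ.+-monoˡ-≤ _ (ℕ.m≤m*n 2000 (16 ℕ.+ d)) ⟩
  2000 ℕ.* (16 ℕ.+ d) ℕ.+ 2000 ℕ.* (16 ℕ.+ d)   ≤⟨ ℕ.+-mono-≤ (2000*[16+d]≤2^[15+d] d) (2000*[16+d]≤2^[15+d] d) ⟩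
  2 ℕ.^ (15 ℕ.+ d) ℕ.+ 2 ℕ.^ (15 ℕ.+ d)         ≡⟨ cong (2 ℕ.^ (15 ℕ.+ d) ℕ.+_) (sym (ℕ.+-identityʳ _)) ⟩
  2 ℕ.^ (15 ℕ.+ suc d)                          ∎
  where open ℕ.≤-Reasoning

-- With `n` rounded down to a multiple `q ℕ.* 1000`, taking 1000th roots leaves
-- `2 ℕ.* n ℕ.≤ 2 ℕ.^ q`, a linear bound against an exponential one.
[2*n]^1000≤2^n : ∀ n → 15000 ℕ.≤ n → (2 ℕ.* n) ℕ.^ 1000 ℕ.≤ 2 ℕ.^ n
[2*n]^1000≤2^n n le = begin
  (2 ℕ.* n) ℕ.^ 1000   ≤⟨ ℕ.^-monoˡ-≤ 1000 2n≤2^q ⟩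
  (2 ℕ.^ q) ℕ.^ 1000   ≡⟨ ℕ.^-*-assoc 2 q 1000 ⟩
  2 ℕ.^ (q ℕ.* 1000)   ≤⟨ ℕ.^-monoʳ-≤ 2 (m/n*n≤m n 1000) ⟩
  2 ℕ.^ n              ∎
  where
  open ℕ.≤-Reasoning
  q = n ℕ./ 1000
  15≤q : 15 ℕ.≤ q
  15≤q = /-monoˡ-≤ 1000 le
  n≤1000*[1+q] : n ℕ.≤ 1000 ℕ.* suc q
  n≤1000*[1+q] = begin
    n                           ≡⟨ m≡m%n+[m/n]*n n 1000 ⟩
    n ℕ.% 1000 ℕ.+ q ℕ.* 1000   ≤⟨ ℕ.+-monoˡ-≤ (q ℕ.* 1000) (ℕ.<⇒≤ (m%n<n n 1000)) ⟩
    suc q ℕ.* 1000              ≡⟨ ℕ.*-comm (suc q) 1000 ⟩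
    1000 ℕ.* suc q              ∎
  2n≤2^q : 2 ℕ.* n ℕ.≤ 2 ℕ.^ q
  2n≤2^q = begin
    2 ℕ.* n                        ≤⟨ ℕ.*-monoʳ-≤ 2 n≤1000*[1+q] ⟩
    2 ℕ.* (1000 ℕ.* suc q)         ≡⟨ ℕ.*-assoc 2 1000 (suc q) ⟨
    2000 ℕ.* suc q                 ≡⟨ cong (λ m → 2000 ℕ.* suc m) (ℕ.m+[n∸m]≡n 15≤q) ⟨
    2000 ℕ.* (16 ℕ.+ (q ℕ.∸ 15))   ≤⟨ 2000*[16+d]≤2^[15+d] (q ℕ.∸ 15) ⟩
    2 ℕ.^ (15 ℕ.+ (q ℕ.∸ 15))      ≡⟨ cong (2 ℕ.^_) (ℕ.m+[n∸m]≡n 15≤q) ⟩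
    2 ℕ.^ q                        ∎

-- The 1000th power clears the fractional exponent 0.811. The factor `(2 ℕ.* n) ℕ.^ 1000` is then
-- traded for `2 ℕ.^ n`, which completes the `n`-th power of `2 ℕ.* 8 ℕ.^ 1000`.
n*[2*8^n]≤13^k : ∀ n k → 15000 ℕ.≤ n → 811 ℕ.* n ℕ.≤ 1000 ℕ.* k → n ℕ.* (2 ℕ.* 8 ℕ.^ n) ℕ.≤ 13 ℕ.^ k
n*[2*8^n]≤13^k n k n≥ le = ^-cancelˡ-≤ 1000 (begin
  (n ℕ.* (2 ℕ.* 8 ℕ.^ n)) ℕ.^ 1000            ≡⟨ cong (ℕ._^ 1000) (x∙yz≈y∙xz n 2 (8 ℕ.^ n)) ⟩
  (2 ℕ.* (n ℕ.* 8 ℕ.^ n)) ℕ.^ 1000            ≡⟨ cong (ℕ._^ 1000) (ℕ.*-assoc 2 n (8 ℕ.^ n)) ⟨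
  (2 ℕ.* n ℕ.* 8 ℕ.^ n) ℕ.^ 1000              ≡⟨ ^-distribʳ-* (2 ℕ.* n) (8 ℕ.^ n) 1000 ⟩
  (2 ℕ.* n) ℕ.^ 1000 ℕ.* (8 ℕ.^ n) ℕ.^ 1000   ≤⟨ ℕ.*-monoˡ-≤ _ ([2*n]^1000≤2^n n n≥) ⟩
  2 ℕ.^ n ℕ.* (8 ℕ.^ n) ℕ.^ 1000              ≡⟨ cong (2 ℕ.^ n ℕ.*_) (^-comm 8 n 1000) ⟩
  2 ℕ.^ n ℕ.* (8 ℕ.^ 1000) ℕ.^ n              ≡⟨ ^-distribʳ-* 2 (8 ℕ.^ 1000) n ⟨
  (2 ℕ.* 8 ℕ.^ 1000) ℕ.^ n                    ≤⟨ ℕ.^-monoˡ-≤ n 2*8^1000≤13^811 ⟩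
  (13 ℕ.^ 811) ℕ.^ n                          ≡⟨ ℕ.^-*-assoc 13 811 n ⟩
  13 ℕ.^ (811 ℕ.* n)                          ≤⟨ ℕ.^-monoʳ-≤ 13 le ⟩
  13 ℕ.^ (1000 ℕ.* k)                         ≡⟨ cong (13 ℕ.^_) (ℕ.*-comm 1000 k) ⟩
  13 ℕ.^ (k ℕ.* 1000)                         ≡⟨ ℕ.^-*-assoc 13 k 1000 ⟨
  (13 ℕ.^ k) ℕ.^ 1000                         ∎)
  where open ℕ.≤-Reasoning

≮-threshold : ∀ k n → ¬ (+ k / 1 < (+ 811 / 1000) * (+ n / 1)) → 811 ℕ.* n ℕ.≤ 1000 ℕ.* k
≮-threshold k n ≮ = ι-cancel-≤ (begin
  ι (811 ℕ.* n)                     ≡⟨ ι-* 811 n ⟩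
  -- `ι 811` and `ι 1000 * (+ 811 / 1000)` are closed terms that agree by evaluation.
  ι 1000 * (+ 811 / 1000) * ι n     ≡⟨ *-assoc (ι 1000) (+ 811 / 1000) (ι n) ⟩
  ι 1000 * ((+ 811 / 1000) * ι n)   ≤⟨ *-monoˡ-≤-nonNeg (ι 1000) (≮⇒≥ ≮) ⟩
  ι 1000 * ι k                      ≡⟨ ι-* 1000 k ⟨
  ι (1000 ℕ.* k)                    ∎)
  where open ≤-Reasoning

atypical⇒deviation : .{{_ : NonZero n}} → n ℕ.> 15000 → (G : Graph n) →
  ¬ ((+ κQ G / 1) < ((+ 811 / 1000) * (+ n / 1))) → n ℕ.* (2 ℕ.* 8 ℕ.^ n) ℕ.≤ deviation G
atypical⇒deviation {n@(suc _)} n>15000 G ≮ =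
  ℕ.≤-trans (n*[2*8^n]≤13^k n (κQ G) (ℕ.<⇒≤ n>15000) bound) (uniformPair⇒deviation G (κQ-uniformPair G 0<κQ))
  where
  bound : 811 ℕ.* n ℕ.≤ 1000 ℕ.* κQ G
  bound = ≮-threshold (κQ G) n ≮
  -- Positivity is needed because an empty WOD set may have an empty witness.
  0<κQ : 0 ℕ.< κQ G
  0<κQ = ℕ.*-cancelˡ-< 1000 0 (κQ G) (ℕ.<-≤-trans ℕ.z<s bound)

theorem9 : ∃ λ n₀ → ∀ n → .{{_ : NonZero n}} → n ℕ.> n₀ →
    Pr (G½ n) (λ G → (+ κQ G / 1) <? ((+ 811 / 1000) * (+ n / 1))) ≥ 1ℚ - (+ 1 / n)
theorem9 = 15000 , λ n n>15000 →
  markov-1/n (isProbability-G½ n) (λ G → (+ κQ G / 1) <? ((+ 811 / 1000) * (+ n / 1)))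
    deviation n (2 ℕ.* 8 ℕ.^ n) {{M≢0 = ℕ.m*n≢0 2 (8 ℕ.^ n) {{_}} {{ℕ.m^n≢0 8 n}}}}
    (atypical⇒deviation n>15000) (E-deviation n)
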